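{- Let $q$ be a prime power, let $H$ be a normalized generalized Hadamard matrix $\mathrm{GH}(q,v/q)$ over $\mathbb{F}_q$, and let $(C,\star)$, with $C=C_H$, be a generalized Hadamard full propelinear code (GHFP-code) of length $v$ over $\mathbb{F}_q$ coming from $H$. Let $D_1$ be the set of $x\in C_H$ whose first coordinate is $0$. Then $F_H=D_1$ is a central relative $(v,q,v,v/q)$-difference set in the group $(C,\star)$ relative to the normal subgroup $C_1=\{\alpha\mathbf 1:\alpha\in\mathbb{F}_q\}\cong\mathbb{F}_q$.
   Context: Generalized Hadamard codes. A $v\times v$ matrix $H=(h_{ij})$ over the additive group $\mathbb{F}_q$, $q\mid v$, is a $\mathrm{GH}(q,v/q)$ if for all $i<j$ the multiset $\{h_{ik}-h_{jk}:1\le k\le v\}$ contains each element of $\mathbb{F}_q$ exactly $v/q$ times; it is normalized if its first row and column are zero. $F_H\subseteq\mathbb{F}_q^v$ is the set of rows of $H$ and $C_H=\bigcup_{\alpha\in\mathbb{F}_q}(F_H+\alpha\mathbf 1)$, with $\mathbf 1$ the all-one vector, is called a generalized Hadamard code. Full propelinear codes. For $\pi\in\mathcal{S}_n$ and $y\in\mathbb{F}_q^n$, $\pi(y)=(y_{\pi^{ -1}(1)},\dots,y_{\pi^{ -1}(n)})$. A code $C\subseteq\mathbb{F}_q^n$ with $\mathbf 0\in C$ is full propelinear if to every $x\in C$ is assigned $\pi_x\in\mathcal{S}_n$ such that, writing $x\star y=x+\pi_x(y)$: (i) $x\star C=C$ for all $x\in C$; (ii) $\pi_{x\star y}=\pi_x\circ\pi_y$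 for all $x,y\in C$; (iii) $\pi_x$ fixes no coordinate if $x\notin\{\alpha\mathbf 1:\alpha\in\mathbb{F}_q\}$, and $\pi_x=\mathrm{Id}$ if $x=\alpha\mathbf 1$ for some $\alpha\in\mathbb{F}_q$. Then $(C,\star)$ is a group with identity $\mathbf 0$. A GHFP-code is a generalized Hadamard code that is full propelinear. Relative difference sets. Let $E$ be a group of order $vw$ with a normal subgroup $Z$ of order $w$. A $k$-subset $R$ of $E$ is a relative $(v,w,k,\lambda)$-difference set in $E$ relative to (with forbidden subgroup) $Z$ if the multiset of quotients $r_1r_2^{ -1}$ with $r_1,r_2\in R$, $r_1\neq r_2$, contains each element of $E\setminus Z$ exactly $\lambda$ times and no element of $Z$. It is called central if $Z$ is a central subgroup of $E$. -}

module Defs where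

open import Level using (Level; 0ℓ; _⊔_)
open import Algebra.Apartness.Structures using (IsHeytingField)
open import Algebra.Bundles using (Group)
open import Algebra.Morphism.Structures using (module GroupMorphisms)
open import Data.Fin.Base using (Fin; zero) renaming (_<_ to _<ᶠ_)
open import Data.Fin.Permutation using (Permutation′; _⟨$⟩ʳ_; _⟨$⟩ˡ_; _∘ₚ_) renaming (id to idₚ; _≈_ to _≈ₚ_)
import Data.Fin.Permutation as Perm
open import Data.Nat.Base using (ℕ; suc; _^_) renaming (_*_ to _*ℕ_)
open import Data.Nat.Divisibility using (_∣_; quotient)
open import Data.Nat.Primality using (Prime)
open import Data.Product.Base using (Σ; ∃; ∃₂; ∃-syntax; Σ-syntax; _×_; _,_; proj₁; proj₂)
open import Data.Product.Relation.Binary.Pointwise.NonDependent using (_×ₛ_)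
open import Data.Vec.Base using (Vec; lookup; tabulate; replicate; zipWith)
open import Data.Vec.Properties using (lookup∘tabulate; tabulate∘lookup; tabulate-cong; lookup-zipWith; lookup-replicate; zipWith-assoc; zipWith-identityˡ; zipWith-identityʳ)
open import Function.Base using (_∘_)
open import Function.Bundles using (Inverse)
open import Relation.Binary.Bundles using (Setoid)
open import Relation.Binary.Definitions using (_Respects_)
open import Relation.Binary.PropositionalEquality using (_≡_; _≢_; refl; sym; trans; cong; cong₂; module ≡-Reasoning)
import Relation.Binary.PropositionalEquality as ≡
import Relation.Binary.Construct.On as On
open import Relation.Nullary using (¬_)
open import Relation.Unary using (Pred; _∈_; _∉_; _≐_)

private
  variable
    a b c p r ℓ ℓ₁ ℓ₂ : Level

HasSize : Setoid a ℓ → ℕ → Set (a ⊔ ℓ)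
HasSize S n = Inverse S (≡.setoid (Fin n))

infix 5 _↾_

-- The equality of S ↾ P ignores the membership proofs.
_↾_ : (S : Setoid a ℓ) → Pred (Setoid.Carrier S) p → Setoid (a ⊔ p) ℓ
S ↾ P = On.setoid S (proj₁ {B = P})

-- The multiset { f i : i ∈ I } contains e exactly n times.
Contains : (I : Setoid a ℓ₁) (S : Setoid b ℓ₂) →
           (Setoid.Carrier I → Setoid.Carrier S) →
           Setoid.Carrier S → ℕ → Set (a ⊔ ℓ₁ ⊔ ℓ₂)
Contains I S f e n = HasSize (I ↾ λ i → Setoid._≈_ S (f i) e) n

module _ (E : Group c ℓ) where
  open Group E using (Carrier; _≈_; _∙_; ε; _⁻¹; setoid; rawGroup)

  record IsSubgroup (Z : Pred Carrier p) : Set (c ⊔ ℓ ⊔ p) where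
    field
      resp      : Z Respects _≈_
      ε-closed  : ε ∈ Z
      ∙-closed  : ∀ {x y} → x ∈ Z → y ∈ Z → x ∙ y ∈ Z
      ⁻¹-closed : ∀ {x} → x ∈ Z → x ⁻¹ ∈ Z

    group : Group (c ⊔ p) ℓ
    group = record
      { Carrier = ∃ Z
      ; _≈_     = λ x y → proj₁ x ≈ proj₁ y
      ; _∙_     = λ x y → proj₁ x ∙ proj₁ y , ∙-closed (proj₂ x) (proj₂ y)
      ; ε       = ε , ε-closed
      ; _⁻¹     = λ x → proj₁ x ⁻¹ , ⁻¹-closed (proj₂ x)
      ; isGroup = record
        { isMonoid = record
          { isSemigroup = record
            { isMagma = record
              { isEquivalence = Setoid.isEquivalence (setoid ↾ Z)
              ; ∙-cong        = Group.∙-cong E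
              }
            ; assoc = λ x y z → Group.assoc E (proj₁ x) (proj₁ y) (proj₁ z)
            }
          ; identity = (λ x → Group.identityˡ E (proj₁ x)) , (λ x → Group.identityʳ E (proj₁ x))
          }
        ; inverse = (λ x → Group.inverseˡ E (proj₁ x)) , (λ x → Group.inverseʳ E (proj₁ x))
        ; ⁻¹-cong = Group.⁻¹-cong E
        }
      }

  record IsNormalSubgroup (Z : Pred Carrier p) : Set (c ⊔ ℓ ⊔ p) where
    field
      isSubgroup : IsSubgroup Z
      conjugate  : ∀ g {z} → z ∈ Z → g ∙ z ∙ g ⁻¹ ∈ Z

    open IsSubgroup isSubgroup public

  record IsRelativeDifferenceSet (R : Pred Carrier r) (Z : Pred Carrier p)
                                 (v w k lam : ℕ) : Set (c ⊔ ℓ ⊔ r ⊔ p) where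
    DistinctPairs : Setoid (c ⊔ ℓ ⊔ r) ℓ
    DistinctPairs = (setoid ×ₛ setoid) ↾ λ (r₁ , r₂) → r₁ ∈ R × r₂ ∈ R × ¬ r₁ ≈ r₂

    quotients : Setoid.Carrier DistinctPairs → Carrier
    quotients ((r₁ , r₂) , _) = r₁ ∙ r₂ ⁻¹

    field
      order             : HasSize setoid (v *ℕ w)
      isNormalSubgroup  : IsNormalSubgroup Z
      order-Z           : HasSize (setoid ↾ Z) w
      R-resp            : R Respects _≈_
      size-R            : HasSize (setoid ↾ R) k
      quotients-outside : ∀ e → e ∉ Z → Contains DistinctPairs setoid quotients e lam
      quotients-inside  : ∀ d → quotients d ∉ Z

    open IsNormalSubgroup isNormalSubgroup public

  IsCentral : Pred Carrier p → Set (c ⊔ ℓ ⊔ p)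
  IsCentral Z = ∀ {z} → z ∈ Z → ∀ g → z ∙ g ≈ g ∙ z

  record IsCentralRelativeDifferenceSet (R : Pred Carrier r) (Z : Pred Carrier p)
                                        (v w k lam : ℕ) : Set (c ⊔ ℓ ⊔ r ⊔ p) where
    field
      isRelativeDifferenceSet : IsRelativeDifferenceSet R Z v w k lam
      central                 : IsCentral Z

    open IsRelativeDifferenceSet isRelativeDifferenceSet public

infix 4 _≅_

_≅_ : Group a ℓ₁ → Group b ℓ₂ → Set (a ⊔ b ⊔ ℓ₁ ⊔ ℓ₂)
G ≅ H = ∃ IsGroupIsomorphism
  where open GroupMorphisms (Group.rawGroup G) (Group.rawGroup H)

IsPrimePower : ℕ → Set
IsPrimePower q = ∃₂ λ p k → Prime p × q ≡ p ^ suc k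

-- With _≢_ as the apartness, a Heyting field is a field in the classical
-- sense: x is invertible if and only if x ≢ 0#; in particular 0# ≢ 1#.
record FiniteField (q : ℕ) : Set₁ where
  infixl 7 _*_
  infixl 6 _+_
  infix  8 -_
  field
    Carrier        : Set
    _+_ _*_        : Carrier → Carrier → Carrier
    -_             : Carrier → Carrier
    0# 1#          : Carrier
    isHeytingField : IsHeytingField _≡_ _≢_ _+_ _*_ -_ 0# 1#
    size           : HasSize (≡.setoid Carrier) q

  open IsHeytingField isHeytingField public
    using (_-_; +-isGroup; +-assoc; +-identityˡ; +-identityʳ)

  +-group : Group 0ℓ 0ℓ
  +-group = record { isGroup = +-isGroup }

permute : {A : Set} {n : ℕ} → Permutation′ n → Vec A n → Vec A n
permute π y = tabulate λ i → lookup y (π ⟨$⟩ˡ i)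

module _ {q : ℕ} (𝔽 : FiniteField q) where
  open FiniteField 𝔽

  Matrix : ℕ → Set
  Matrix v = Vec (Vec Carrier v) v

  infixl 6 _⊕_

  _⊕_ : ∀ {n} → Vec Carrier n → Vec Carrier n → Vec Carrier n
  _⊕_ = zipWith _+_

  Code : ℕ → Set₁
  Code n = Pred (Vec Carrier n) 0ℓ

  entry : ∀ {v} → Matrix v → Fin v → Fin v → Carrier
  entry H i j = lookup (lookup H i) j

  -- GH(q, v/q), where quotient q∣v is v/q.
  IsGH : ∀ {v} → q ∣ v → Matrix v → Set
  IsGH {v} q∣v H = ∀ i j → i <ᶠ j → ∀ e →
    Contains (≡.setoid (Fin v)) (≡.setoid Carrier)
      (λ k → entry H i k - entry H j k) e (quotient q∣v)

  IsNormalized : ∀ {m} → Matrix (suc m) → Set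
  IsNormalized H = (∀ j → entry H zero j ≡ 0#) × (∀ i → entry H i zero ≡ 0#)

  Constants : ∀ n → Code n
  Constants n x = ∃[ α ] x ≡ replicate n α

  Rows : ∀ {v} → Matrix v → Code v
  Rows H x = ∃[ i ] x ≡ lookup H i

  HadamardCode : ∀ {v} → Matrix v → Code v
  HadamardCode {v} H x = ∃₂ λ f α → f ∈ Rows H × x ≡ f ⊕ replicate v α

  FirstCoordinateZero : ∀ {m} → Code (suc m) → Code (suc m)
  FirstCoordinateZero C x = x ∈ C × lookup x zero ≡ 0#

  -- The membership argument of π is irrelevant, so that π x depends on the
  -- codeword x only and not on the proof that it belongs to C.
  record FullPropelinear {n : ℕ} (C : Code n) : Set where
    field
      π : ∀ x → .(x ∈ C) → Permutation′ n

    star : ∀ x → .(x ∈ C) → Vec Carrier n → Vec Carrier n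
    star x x∈C y = x ⊕ permute (π x x∈C) y

    field
      0∈C         : replicate n 0# ∈ C
      star-C      : ∀ x (x∈C : x ∈ C) → (λ z → ∃[ y ] y ∈ C × z ≡ star x x∈C y) ≐ C
      π-star      : ∀ x y (x∈C : x ∈ C) (y∈C : y ∈ C) (x⋆y∈C : star x x∈C y ∈ C) →
                    ∀ i → π (star x x∈C y) x⋆y∈C ⟨$⟩ʳ i ≡ π x x∈C ⟨$⟩ʳ (π y y∈C ⟨$⟩ʳ i)
      π-fixfree   : ∀ x (x∈C : x ∈ C) → x ∉ Constants n → ∀ i → π x x∈C ⟨$⟩ʳ i ≢ i
      π-constants : ∀ x (x∈C : x ∈ C) → x ∈ Constants n → π x x∈C ≈ₚ idₚ

  module StarGroup {n : ℕ} {C : Code n} (P : FullPropelinear C) where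
    open FullPropelinear P

    W : Set
    W = ∃ C

    𝟘 : Vec Carrier n
    𝟘 = replicate n 0#

    inv-cong : (σ τ : Permutation′ n) → σ ≈ₚ τ → ∀ i → σ ⟨$⟩ˡ i ≡ τ ⟨$⟩ˡ i
    inv-cong σ τ σ≈τ i = begin
      σ ⟨$⟩ˡ i                       ≡⟨ cong (σ ⟨$⟩ˡ_) (Perm.inverseʳ τ) ⟨
      σ ⟨$⟩ˡ (τ ⟨$⟩ʳ (τ ⟨$⟩ˡ i))      ≡⟨ cong (σ ⟨$⟩ˡ_) (σ≈τ (τ ⟨$⟩ˡ i)) ⟨
      σ ⟨$⟩ˡ (σ ⟨$⟩ʳ (τ ⟨$⟩ˡ i))      ≡⟨ Perm.inverseˡ σ ⟩
      τ ⟨$⟩ˡ i                       ∎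
      where open ≡-Reasoning

    permute-cong : (σ τ : Permutation′ n) → σ ≈ₚ τ → ∀ (y : Vec Carrier n) → permute σ y ≡ permute τ y
    permute-cong σ τ σ≈τ y = tabulate-cong λ i → cong (lookup y) (inv-cong σ τ σ≈τ i)

    permute-∘ : (σ τ : Permutation′ n) (y : Vec Carrier n) →
                permute (τ ∘ₚ σ) y ≡ permute σ (permute τ y)
    permute-∘ σ τ y = tabulate-cong λ i → sym (lookup∘tabulate _ (σ ⟨$⟩ˡ i))

    permute-⊕ : (σ : Permutation′ n) (x y : Vec Carrier n) →
                permute σ (x ⊕ y) ≡ permute σ x ⊕ permute σ y
    permute-⊕ σ x y = begin
      tabulate (λ i → lookup (x ⊕ y) (σ ⟨$⟩ˡ i))  ≡⟨ tabulate-cong pointwise ⟩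
      tabulate (lookup (permute σ x ⊕ permute σ y)) ≡⟨ tabulate∘lookup _ ⟩
      permute σ x ⊕ permute σ y                    ∎
      where
      open ≡-Reasoning
      pointwise : ∀ i → lookup (x ⊕ y) (σ ⟨$⟩ˡ i) ≡ lookup (permute σ x ⊕ permute σ y) i
      pointwise i = begin
        lookup (x ⊕ y) (σ ⟨$⟩ˡ i)
          ≡⟨ lookup-zipWith _+_ (σ ⟨$⟩ˡ i) x y ⟩
        lookup x (σ ⟨$⟩ˡ i) + lookup y (σ ⟨$⟩ˡ i)
          ≡⟨ cong₂ _+_ (lookup∘tabulate _ i) (lookup∘tabulate _ i) ⟨
        lookup (permute σ x) i + lookup (permute σ y) i
          ≡⟨ lookup-zipWith _+_ i (permute σ x) (permute σ y) ⟨
        lookup (permute σ x ⊕ permute σ y) i ∎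

    permute-𝟘 : (σ : Permutation′ n) → permute σ 𝟘 ≡ 𝟘
    permute-𝟘 σ = trans
      (tabulate-cong λ i → trans (lookup-replicate (σ ⟨$⟩ˡ i) 0#) (sym (lookup-replicate i 0#)))
      (tabulate∘lookup 𝟘)

    infixl 7 _⋆_
    infix 4 _≈_

    _≈_ : W → W → Set
    x ≈ y = proj₁ x ≡ proj₁ y

    _⋆_ : W → W → W
    (x , x∈C) ⋆ (y , y∈C) = star x x∈C y , proj₁ (star-C x x∈C) (y , y∈C , refl)

    ι : W
    ι = 𝟘 , 0∈C

    ⋆-cong : ∀ {x x′ y y′} → x ≈ x′ → y ≈ y′ → x ⋆ y ≈ x′ ⋆ y′
    ⋆-cong refl refl = refl

    ⋆-assoc : ∀ x y z → (x ⋆ y) ⋆ z ≈ x ⋆ (y ⋆ z)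
    ⋆-assoc X@(x , x∈C) Y@(y , y∈C) (z , z∈C) = begin
      (x ⊕ permute πx y) ⊕ permute (π (proj₁ (X ⋆ Y)) (proj₂ (X ⋆ Y))) z
        ≡⟨ cong ((x ⊕ permute πx y) ⊕_) (permute-cong (π (proj₁ (X ⋆ Y)) (proj₂ (X ⋆ Y))) (πy ∘ₚ πx) (π-star x y x∈C y∈C (proj₂ (X ⋆ Y))) z) ⟩
      (x ⊕ permute πx y) ⊕ permute (πy ∘ₚ πx) z
        ≡⟨ cong ((x ⊕ permute πx y) ⊕_) (permute-∘ πx πy z) ⟩
      (x ⊕ permute πx y) ⊕ permute πx (permute πy z)
        ≡⟨ zipWith-assoc +-assoc x _ _ ⟩
      x ⊕ (permute πx y ⊕ permute πx (permute πy z))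
        ≡⟨ cong (x ⊕_) (permute-⊕ πx y _) ⟨
      x ⊕ permute πx (y ⊕ permute πy z) ∎
      where
      open ≡-Reasoning
      πx πy : Permutation′ n
      πx = π x x∈C
      πy = π y y∈C

    ⋆-identityˡ : ∀ x → ι ⋆ x ≈ x
    ⋆-identityˡ (x , x∈C) = begin
      𝟘 ⊕ permute (π 𝟘 0∈C) x ≡⟨ cong (𝟘 ⊕_) (permute-cong (π 𝟘 0∈C) idₚ (π-constants 𝟘 0∈C (0# , refl)) x) ⟩
      𝟘 ⊕ permute idₚ x       ≡⟨ cong (𝟘 ⊕_) (tabulate∘lookup x) ⟩
      𝟘 ⊕ x                   ≡⟨ zipWith-identityˡ +-identityˡ x ⟩
      x                       ∎
      where open ≡-Reasoning

    ⋆-identityʳ : ∀ x → x ⋆ ι ≈ x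
    ⋆-identityʳ (x , x∈C) = trans (cong (x ⊕_) (permute-𝟘 (π x x∈C))) (zipWith-identityʳ +-identityʳ x)

    -- A right inverse exists because 𝟘 ∈ C = x ⋆ C.
    _⁻ : W → W
    (x , x∈C) ⁻ = let (y , y∈C , _) = proj₂ (star-C x x∈C) 0∈C in y , y∈C

    ⋆-inverseʳ : ∀ x → x ⋆ x ⁻ ≈ ι
    ⋆-inverseʳ (x , x∈C) = sym (proj₂ (proj₂ (proj₂ (star-C x x∈C) 0∈C)))

    ⋆-inverse-unique : ∀ x y z → x ⋆ y ≈ ι → y ⋆ z ≈ ι → x ≈ z
    ⋆-inverse-unique x y z xy yz = begin
      proj₁ x               ≡⟨ ⋆-identityʳ x ⟨
      proj₁ (x ⋆ ι)         ≡⟨ ⋆-cong {x = x} {x′ = x} {y = y ⋆ z} {y′ = ι} refl yz ⟨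
      proj₁ (x ⋆ (y ⋆ z))   ≡⟨ ⋆-assoc x y z ⟨
      proj₁ (x ⋆ y ⋆ z)     ≡⟨ ⋆-cong {x = x ⋆ y} {x′ = ι} {y = z} {y′ = z} xy refl ⟩
      proj₁ (ι ⋆ z)         ≡⟨ ⋆-identityˡ z ⟩
      proj₁ z               ∎
      where open ≡-Reasoning

    ⋆-inverseˡ : ∀ x → x ⁻ ⋆ x ≈ ι
    ⋆-inverseˡ x = trans
      (⋆-cong {x = x ⁻} {x′ = x ⁻} {y = x} {y′ = x ⁻ ⁻} refl (⋆-inverse-unique x (x ⁻) (x ⁻ ⁻) (⋆-inverseʳ x) (⋆-inverseʳ (x ⁻))))
      (⋆-inverseʳ (x ⁻))

    ⁻-cong : ∀ {x y} → x ≈ y → x ⁻ ≈ y ⁻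
    ⁻-cong {x} {y} x≈y = ⋆-inverse-unique (x ⁻) x (y ⁻) (⋆-inverseˡ x)
      (trans (⋆-cong {x = x} {x′ = y} {y = y ⁻} {y′ = y ⁻} x≈y refl) (⋆-inverseʳ y))

    propelinearGroup : Group 0ℓ 0ℓ
    propelinearGroup = record
      { Carrier = W
      ; _≈_     = _≈_
      ; _∙_     = _⋆_
      ; ε       = ι
      ; _⁻¹     = _⁻
      ; isGroup = record
        { isMonoid = record
          { isSemigroup = record
            { isMagma = record
              { isEquivalence = Setoid.isEquivalence (≡.setoid (Vec Carrier n) ↾ C)
              ; ∙-cong        = λ {x} {x′} {y} {y′} → ⋆-cong {x} {x′} {y} {y′}
              }
            ; assoc = ⋆-assoc
            }
          ; identity = ⋆-identityˡ , ⋆-identityʳ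
          }
        ; inverse = ⋆-inverseˡ , ⋆-inverseʳ
        ; ⁻¹-cong = λ {x} {y} → ⁻-cong {x} {y}
        }
      }

    within : Code n → Pred (Group.Carrier propelinearGroup) 0ℓ
    within D (x , _) = x ∈ D

  open StarGroup public using (propelinearGroup; within)

{-# OPTIONS --safe #-}

-- Fix e ∉ C₁ and let j = π_e⁻¹(1) ≠ 1.  A pair (r₁ , r₂) of rows has quotient e
-- iff r₁ = e ⋆ r₂; and e ⋆ r₂ is a row iff its first coordinate e₁ + (r₂)_j
-- vanishes, i.e. iff the entry of the row r₂ in column j is - e₁.  So the claim
-- reduces to: every column of H but the first contains each field element v/q times.
--
-- For that, let N_e be the number of times e occurs among the differences of two
-- rows (or of two columns), so that Σ_e N_e = v.  Summing Σ_e N_e² over all pairs of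
-- rows counts the quadruples with h_ik - h_i'k = h_ik' - h_i'k', which is symmetric
-- in rows and columns.  Hence the total of Σ_e (N_e - v/q)² is the same for rows and
-- columns.  The pairs i = i' contribute equally to both, the other pairs of rows
-- contribute nothing, and so neither do the other pairs of columns.

module Submission where

open import Defs
open import Algebra.Bundles using (Group; AbelianGroup)
import Algebra.Apartness.Properties.HeytingCommutativeRing as HeytingProperties
import Algebra.Properties.AbelianGroup as AbelianGroupProperties
import Algebra.Properties.Group as GroupProperties
open import Algebra.Apartness.Bundles using (HeytingCommutativeRing)
open import Algebra.Apartness.Structures using (IsHeytingField)
open import Data.Fin.Base using (Fin; zero; suc; combine; remQuot; punchIn; punchOut) renaming (_<_ to _<ᶠ_)
open import Data.Fin.Permutation using (↔⇒≡; _⟨$⟩ʳ_; _⟨$⟩ˡ_)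
import Data.Fin.Permutation as Perm
open import Data.Fin.Properties using (_≟_; <-cmp; punchIn-punchOut; punchInᵢ≢i; combine-remQuot; remQuot-combine)
open import Data.Nat.Base using (ℕ; zero; suc; _+_; _*_; ∣_-_∣)
open import Data.Nat.Divisibility using (_∣_; quotient; divides)
open import Data.Nat.Properties
  using (+-*-semiring; +-cancelˡ-≡; +-cancelʳ-≡; +-identityʳ; *-identityˡ; *-identityʳ;
    m+n≡0⇒m≡0; m+n≡0⇒n≡0; m*n≡0⇒m≡0∨n≡0; ∣m-n∣≡0⇒m≡n; ∣n-n∣≡0; ∣m-m+n∣≡n; ∣-∣-comm; ≤-total;
    m≤n⇒∃[o]m+o≡n)
open import Data.Nat.Tactic.RingSolver using (solve-∀)
open import Data.Product.Base using (Σ-syntax; ∃; _×_; _,_; proj₁; proj₂)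
open import Data.Product.Relation.Binary.Pointwise.NonDependent using (_×ₛ_)
open import Data.Sum.Base using (inj₁; inj₂; reduce)
open import Data.Vec.Base using (Vec; lookup; replicate)
open import Data.Vec.Functional using (removeAt)
open import Data.Vec.Properties
  using (lookup∘tabulate; tabulate∘lookup; tabulate-cong; lookup-zipWith; lookup-replicate;
    zipWith-identityʳ; zipWith-comm; zipWith-replicate)
open import Function.Base using (_∘_)
open import Function.Bundles using (Inverse)
open import Function.Consequences.Setoid using (strictlyInverseˡ⇒inverseˡ; strictlyInverseʳ⇒inverseʳ)
import Function.Construct.Composition as Composition
import Function.Construct.Symmetry as Symmetry
open import Level using (Level)
open import Relation.Binary.Bundles using (Setoid)
open import Relation.Binary.Definitions using (tri<; tri≈; tri>; _Respects_)
open import Relation.Binary.PropositionalEquality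
  using (_≡_; _≢_; refl; sym; trans; cong; cong₂; subst; setoid; module ≡-Reasoning)
open import Relation.Nullary using (¬_; Dec; yes; no; contradiction)
open import Relation.Unary using (Pred; Decidable; _∈_; _∉_; _≐_)
open import Algebra.Properties.Semiring.Sum +-*-semiring

private
  variable
    a b p r ℓ ℓ₁ ℓ₂ : Level
    n q : ℕ

-- Sizes of setoids

module _ {S : Setoid a ℓ₁} {T : Setoid b ℓ₂} where
  private
    module S = Setoid S
    module T = Setoid T

  mkInverse : (f : S.Carrier → T.Carrier) (g : T.Carrier → S.Carrier) →
              (∀ {x y} → x S.≈ y → f x T.≈ f y) → (∀ {x y} → x T.≈ y → g x S.≈ g y) →
              (∀ y → f (g y) T.≈ y) → (∀ x → g (f x) S.≈ x) → Inverse S T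
  mkInverse f g f-cong g-cong fg gf = record
    { to        = f
    ; from      = g
    ; to-cong   = f-cong
    ; from-cong = g-cong
    ; inverse   = strictlyInverseˡ⇒inverseˡ S T f-cong fg , strictlyInverseʳ⇒inverseʳ S T g-cong gf
    }

  HasSize-resp : Inverse S T → HasSize T n → HasSize S n
  HasSize-resp = Composition.inverse

module _ (S : Setoid a ℓ) where
  open Setoid S using (Carrier; _≈_)

  mkHasSize : (f : Carrier → Fin n) (g : Fin n → Carrier) →
              (∀ {x y} → x ≈ y → f x ≡ f y) → (∀ k → f (g k) ≡ k) → (∀ x → g (f x) ≈ x) →
              HasSize S n
  mkHasSize f g f-cong = mkInverse {S = S} f g f-cong λ { refl → Setoid.refl S }

HasSize-unique : {S : Setoid a ℓ} {m n : ℕ} → HasSize S m → HasSize S n → m ≡ n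
HasSize-unique S≃m S≃n = ↔⇒≡ (Composition.inverse (Symmetry.inverse S≃m) S≃n)

-- Equality on a restriction ignores membership proofs, so both composites of the two inclusions are
-- trivially the identity.
↾-resp : (S : Setoid a ℓ) {P : Pred (Setoid.Carrier S) p} {Q : Pred (Setoid.Carrier S) r} →
         P ≐ Q → Inverse (S ↾ P) (S ↾ Q)
↾-resp S {P} {Q} (P⊆Q , Q⊆P) = mkInverse {S = S ↾ P} {T = S ↾ Q}
  (λ (x , Px) → x , P⊆Q Px) (λ (x , Qx) → x , Q⊆P Qx)
  (λ x≈y → x≈y) (λ x≈y → x≈y) (λ _ → Setoid.refl S) (λ _ → Setoid.refl S)

inhabitant : {S : Setoid a ℓ} → HasSize S n → n ≢ 0 → Setoid.Carrier S
inhabitant {n = zero}  S≃n n≢0 = contradiction refl n≢0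
inhabitant {n = suc _} S≃n n≢0 = Inverse.from S≃n zero

-- Counting

⟦_⟧ : {P : Set p} → Dec P → ℕ
⟦ yes _ ⟧ = 1
⟦ no  _ ⟧ = 0

⟦⟧-cong : {P : Set p} {Q : Set r} (P? : Dec P) (Q? : Dec Q) → (P → Q) → (Q → P) → ⟦ P? ⟧ ≡ ⟦ Q? ⟧
⟦⟧-cong (yes p) (yes q) f g = refl
⟦⟧-cong (yes p) (no ¬q) f g = contradiction (f p) ¬q
⟦⟧-cong (no ¬p) (yes q) f g = contradiction (g q) ¬p
⟦⟧-cong (no ¬p) (no ¬q) f g = refl

count : {P : Pred (Fin n) p} → Decidable P → ℕ
count P? = ∑[ i < _ ] ⟦ P? i ⟧

-- Links two notions of size: sums of indicators, which can be rearranged, and bijections with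
-- `Fin`, in which the definitions are stated.
count-size : ∀ n {P : Pred (Fin n) p} (P? : Decidable P) → HasSize (setoid (Fin n) ↾ P) (count P?)
count-size zero {P} P? = mkHasSize (setoid _ ↾ P) (λ ()) (λ ()) (λ { {() , _} }) (λ ()) (λ ())
count-size (suc n) {P} P? with P? zero | count-size n (P? ∘ suc)
... | yes p | ih = mkHasSize (setoid _ ↾ P)
  (λ { (zero , _) → zero ; (suc i , Pi) → suc (to (i , Pi)) })
  (λ { zero → zero , p ; (suc k) → suc (proj₁ (from k)) , proj₂ (from k) })
  (λ { {zero , _} {zero , _} _ → refl ; {suc i , _} {suc .i , _} refl → cong suc (to-cong refl) })
  (λ { zero → refl ; (suc k) → cong suc (strictlyInverseˡ k) })
  (λ { (zero , _) → refl ; (suc i , Pi) → cong suc (strictlyInverseʳ (i , Pi)) })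
  where open Inverse ih
... | no ¬p | ih = mkHasSize (setoid _ ↾ P)
  (λ { (zero , Pi) → contradiction Pi ¬p ; (suc i , Pi) → to (i , Pi) })
  (λ k → suc (proj₁ (from k)) , proj₂ (from k))
  (λ { {zero , Pi} _ → contradiction Pi ¬p ; {suc i , _} {suc .i , _} refl → to-cong refl })
  strictlyInverseˡ
  (λ { (zero , Pi) → contradiction Pi ¬p ; (suc i , Pi) → cong suc (strictlyInverseʳ (i , Pi)) })
  where open Inverse ih

count-unique : {P : Pred (Fin n) p} {Q : Pred (Fin n) r} (P? : Decidable P) → P ≐ Q →
               ∀ {k} → HasSize (setoid (Fin n) ↾ Q) k → count P? ≡ k
count-unique {P = P} {Q} P? P≐Q Q≃k =
  HasSize-unique (count-size _ P?) (HasSize-resp (↾-resp (setoid _) P≐Q) Q≃k)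

-- Sums

sum≡0⇒≡0 : (f : Fin n → ℕ) → sum f ≡ 0 → ∀ i → f i ≡ 0
sum≡0⇒≡0 f Σf≡0 zero    = m+n≡0⇒m≡0 (f zero) Σf≡0
sum≡0⇒≡0 f Σf≡0 (suc i) = sum≡0⇒≡0 (f ∘ suc) (m+n≡0⇒n≡0 (f zero) Σf≡0) i

sum-zero : (f : Fin n → ℕ) → (∀ i → f i ≡ 0) → sum f ≡ 0
sum-zero {n} f f≡0 = trans (sum-cong-≗ f≡0) (sum-replicate-zero n)

-- Kronecker delta: once position `i` is removed, only zero terms remain.
sum-select : (i : Fin n) (f : Fin n → ℕ) → ∑[ j < n ] (⟦ i ≟ j ⟧ * f j) ≡ f i
sum-select {suc n} i f = begin
  sum t                    ≡⟨ sum-remove {i = i} t ⟩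
  t i + sum (removeAt t i) ≡⟨ cong₂ _+_ at-i (sum-zero _ off-i) ⟩
  f i + 0                  ≡⟨ +-identityʳ _ ⟩
  f i                      ∎
  where
  open ≡-Reasoning
  t : Fin (suc n) → ℕ
  t j = ⟦ i ≟ j ⟧ * f j
  at-i : t i ≡ f i
  at-i with i ≟ i
  ... | yes _  = *-identityˡ (f i)
  ... | no i≢i = contradiction refl i≢i
  off-i : ∀ k → t (punchIn i k) ≡ 0
  off-i k with i ≟ punchIn i k
  ... | yes i≡ = contradiction (sym i≡) (punchInᵢ≢i i k)
  ... | no _   = refl

sum-split-diagonal : (F : Fin (suc n) → Fin (suc n) → ℕ) →
  ∑[ i < suc n ] ∑[ j < suc n ] F i j ≡ ∑[ i < suc n ] F i i + ∑[ i < suc n ] sum (removeAt (F i) i)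
sum-split-diagonal F = trans
  (sum-cong-≗ λ i → sum-remove {i = i} (F i))
  (∑-distrib-+ (λ i → F i i) (λ i → sum (removeAt (F i) i)))

diagonal-sum : (F : Fin (suc n) → Fin (suc n) → ℕ) → (∀ i j → i ≢ j → F i j ≡ 0) →
               ∑[ i < suc n ] ∑[ j < suc n ] F i j ≡ ∑[ i < suc n ] F i i
diagonal-sum F F≡0 = trans (sum-split-diagonal F) (trans
  (cong (sum (λ i → F i i) +_) (sum-zero (λ i → sum (removeAt (F i) i)) λ i →
    sum-zero (removeAt (F i) i) λ k → F≡0 i (punchIn i k) (punchInᵢ≢i i k ∘ sym)))
  (+-identityʳ _))

-- Cancelling the diagonal leaves a vanishing sum of natural numbers, so each of its terms vanishes.
off-diagonal≡0 : (F : Fin (suc n) → Fin (suc n) → ℕ) →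
                 ∑[ i < suc n ] ∑[ j < suc n ] F i j ≡ ∑[ i < suc n ] F i i →
                 ∀ i j → i ≢ j → F i j ≡ 0
off-diagonal≡0 F ΣF≡ i j i≢j = subst (λ k → F i k ≡ 0) (punchIn-punchOut i≢j)
  (sum≡0⇒≡0 (removeAt (F i) i) (sum≡0⇒≡0 (λ i → sum (removeAt (F i) i)) rest≡0 i) (punchOut i≢j))
  where
  rest≡0 : sum (λ i → sum (removeAt (F i) i)) ≡ 0
  rest≡0 = +-cancelˡ-≡ (sum λ i → F i i) _ _
    (trans (sym (sum-split-diagonal F)) (trans ΣF≡ (sym (+-identityʳ _))))

∑-comm₃ : ∀ {l m n} (F : Fin l → Fin m → Fin n → ℕ) →
          ∑[ i < l ] ∑[ j < m ] ∑[ k < n ] F i j k ≡ ∑[ k < n ] ∑[ i < l ] ∑[ j < m ] F i j k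
∑-comm₃ F = trans (sum-cong-≗ λ i → ∑-comm (F i)) (∑-comm λ i k → sum λ j → F i j k)

-- The exchange of row pairs with column pairs in the count of quadruples.
∑-comm₄ : ∀ {k l m n} (F : Fin k → Fin l → Fin m → Fin n → ℕ) →
          ∑[ h < k ] ∑[ i < l ] ∑[ j < m ] ∑[ g < n ] F h i j g ≡
          ∑[ j < m ] ∑[ g < n ] ∑[ h < k ] ∑[ i < l ] F h i j g
∑-comm₄ F = trans
  (∑-comm₃ λ h i j → sum (F h i j))
  (sum-cong-≗ λ j → ∑-comm₃ λ h i g → F h i j g)

-- Second moments

fibre : (Fin n → Fin q) → Fin q → ℕ
fibre f e = count λ i → f i ≟ e

-- An unnormalized variance about the target `l`, zero exactly when every fibre has size `l`.
deviation : ℕ → (Fin n → Fin q) → ℕ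
deviation l f = sum λ e → ∣ fibre f e - l ∣ * ∣ fibre f e - l ∣

-- Each index lies in exactly one fibre. The total stays a sum of ones, as only its independence of
-- `f` matters.
fibre-total : (f : Fin n → Fin q) → sum (fibre f) ≡ ∑[ i < n ] 1
fibre-total {n} f = begin
  sum (λ e → sum λ i → ⟦ f i ≟ e ⟧)     ≡⟨ ∑-comm (λ e i → ⟦ f i ≟ e ⟧) ⟩
  sum (λ i → sum λ e → ⟦ f i ≟ e ⟧)     ≡⟨ sum-cong-≗ (λ i → sum-cong-≗ λ e → *-identityʳ ⟦ f i ≟ e ⟧) ⟨
  sum (λ i → sum λ e → ⟦ f i ≟ e ⟧ * 1) ≡⟨ sum-cong-≗ (λ i → sum-select (f i) λ _ → 1) ⟩
  ∑[ i < n ] 1                          ∎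
  where open ≡-Reasoning

-- A squared fibre size counts the pairs of indices with common value `e`; summing over `e` counts
-- all pairs with equal values.
second-moment : (f : Fin n → Fin q) →
  ∑[ e < q ] (fibre f e * fibre f e) ≡ ∑[ i < n ] ∑[ j < n ] ⟦ f j ≟ f i ⟧
second-moment f = begin
  sum (λ e → fibre f e * fibre f e)
    ≡⟨ sum-cong-≗ (λ e → *-distribʳ-sum (fibre f e) λ i → ⟦ f i ≟ e ⟧) ⟩
  sum (λ e → sum λ i → ⟦ f i ≟ e ⟧ * fibre f e)
    ≡⟨ ∑-comm (λ e i → ⟦ f i ≟ e ⟧ * fibre f e) ⟩
  sum (λ i → sum λ e → ⟦ f i ≟ e ⟧ * fibre f e)
    ≡⟨ sum-cong-≗ (λ i → sum-select (f i) (fibre f)) ⟩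
  sum (λ i → fibre f (f i)) ∎
  where open ≡-Reasoning

-- (x - y)² + 2xy = x² + y², which avoids truncated subtraction.
∣-∣-square : ∀ x y → ∣ x - y ∣ * ∣ x - y ∣ + (y + y) * x ≡ x * x + y * y
∣-∣-square x y with ≤-total x y
... | inj₁ x≤y with d , refl ← m≤n⇒∃[o]m+o≡n x≤y rewrite ∣m-m+n∣≡n x d = lemma x d
  where
  lemma : ∀ x d → d * d + (x + d + (x + d)) * x ≡ x * x + (x + d) * (x + d)
  lemma = solve-∀
... | inj₂ y≤x with d , refl ← m≤n⇒∃[o]m+o≡n y≤x rewrite ∣-∣-comm (y + d) y | ∣m-m+n∣≡n y d = lemma y d
  where
  lemma : ∀ y d → d * d + (y + y) * (y + d) ≡ (y + d) * (y + d) + y * y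
  lemma = solve-∀

-- Sum of `(N_e - l)² = N_e² - 2 l N_e + l²` over `e`, with the negative term moved to the left to
-- stay within the natural numbers.
deviation-moment : ∀ l (f : Fin n → Fin q) →
  deviation l f + (l + l) * ∑[ i < n ] 1 ≡ ∑[ i < n ] ∑[ j < n ] ⟦ f j ≟ f i ⟧ + ∑[ e < q ] (l * l)
deviation-moment {n} {q} l f = begin
  deviation l f + (l + l) * ∑[ i < n ] 1
    ≡⟨ cong (λ s → deviation l f + (l + l) * s) (fibre-total f) ⟨
  deviation l f + (l + l) * sum (fibre f)
    ≡⟨ cong (deviation l f +_) (*-distribˡ-sum (l + l) (fibre f)) ⟩
  deviation l f + sum (λ e → (l + l) * fibre f e)
    ≡⟨ ∑-distrib-+ (λ e → ∣ fibre f e - l ∣ * ∣ fibre f e - l ∣) (λ e → (l + l) * fibre f e) ⟨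
  sum (λ e → ∣ fibre f e - l ∣ * ∣ fibre f e - l ∣ + (l + l) * fibre f e)
    ≡⟨ sum-cong-≗ (λ e → ∣-∣-square (fibre f e) l) ⟩
  sum (λ e → fibre f e * fibre f e + l * l)
    ≡⟨ ∑-distrib-+ (λ e → fibre f e * fibre f e) (λ _ → l * l) ⟩
  sum (λ e → fibre f e * fibre f e) + ∑[ e < q ] (l * l)
    ≡⟨ cong (_+ ∑[ e < q ] (l * l)) (second-moment f) ⟩
  sum (λ i → sum λ j → ⟦ f j ≟ f i ⟧) + ∑[ e < q ] (l * l) ∎
  where open ≡-Reasoning

balanced⇒deviation≡0 : ∀ l (f : Fin n → Fin q) → (∀ e → fibre f e ≡ l) → deviation l f ≡ 0
balanced⇒deviation≡0 l f N≡l = sum-zero _ λ e →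
  cong (λ d → d * d) (trans (cong (∣_- l ∣) (N≡l e)) (∣n-n∣≡0 l))

deviation≡0⇒balanced : ∀ l (f : Fin n → Fin q) → deviation l f ≡ 0 → ∀ e → fibre f e ≡ l
deviation≡0⇒balanced l f D≡0 e =
  ∣m-n∣≡0⇒m≡n (reduce (m*n≡0⇒m≡0∨n≡0 ∣ fibre f e - l ∣ (sum≡0⇒≡0 _ D≡0 e)))

-- f i i′ k and g k k′ i stand for h i k - h i′ k and h i k - h i k′.
module _ {m} (f g : Fin (suc m) → Fin (suc m) → Fin (suc m) → Fin q)
         (f⇒g : ∀ i i′ k k′ → f i i′ k′ ≡ f i i′ k → g k k′ i′ ≡ g k k′ i)
         (g⇒f : ∀ i i′ k k′ → g k k′ i′ ≡ g k k′ i → f i i′ k′ ≡ f i i′ k)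
         where

  -- By `deviation-moment` each side is a count of quadruples up to `C` and `d`, which depend on
  -- neither `f` nor `g`. After the exchange of summations the hypotheses match the two counts term
  -- by term.
  deviation-total : ∀ l → sum (λ i → sum λ i′ → deviation l (f i i′)) ≡
                          sum (λ k → sum λ k′ → deviation l (g k k′))
  deviation-total l = +-cancelʳ-≡ C _ _ (begin
    sum (λ i → sum λ i′ → deviation l (f i i′)) + C
      ≡⟨ moments f ⟩
    sum (λ i → sum λ i′ → sum λ k → sum λ k′ → ⟦ f i i′ k′ ≟ f i i′ k ⟧) + d
      ≡⟨ cong (_+ d) (∑-comm₄ λ i i′ k k′ → ⟦ f i i′ k′ ≟ f i i′ k ⟧) ⟩
    sum (λ k → sum λ k′ → sum λ i → sum λ i′ → ⟦ f i i′ k′ ≟ f i i′ k ⟧) + d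
      ≡⟨ cong (_+ d) (sum-cong-≗ λ k → sum-cong-≗ λ k′ → sum-cong-≗ λ i → sum-cong-≗ λ i′ →
           ⟦⟧-cong (f i i′ k′ ≟ f i i′ k) (g k k′ i′ ≟ g k k′ i) (f⇒g i i′ k k′) (g⇒f i i′ k k′)) ⟩
    sum (λ k → sum λ k′ → sum λ i → sum λ i′ → ⟦ g k k′ i′ ≟ g k k′ i ⟧) + d
      ≡⟨ moments g ⟨
    sum (λ k → sum λ k′ → deviation l (g k k′)) + C ∎)
    where
    open ≡-Reasoning
    c C d : ℕ
    c = (l + l) * ∑[ i < suc m ] 1
    C = ∑[ i < suc m ] ∑[ j < suc m ] c
    d = ∑[ i < suc m ] ∑[ i′ < suc m ] ∑[ e < q ] (l * l)
    ∑∑-distrib-+ : (F G : Fin (suc m) → Fin (suc m) → ℕ) →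
      sum (λ i → sum λ j → F i j + G i j) ≡ sum (λ i → sum (F i)) + sum (λ i → sum (G i))
    ∑∑-distrib-+ F G = trans (sum-cong-≗ λ i → ∑-distrib-+ (F i) (G i)) (∑-distrib-+ (sum ∘ F) (sum ∘ G))
    moments : (h : Fin (suc m) → Fin (suc m) → Fin (suc m) → Fin q) →
      sum (λ i → sum λ j → deviation l (h i j)) + C ≡
      sum (λ i → sum λ j → sum λ k → sum λ k′ → ⟦ h i j k′ ≟ h i j k ⟧) + d
    moments h = trans (sym (∑∑-distrib-+ (λ i j → deviation l (h i j)) λ _ _ → c)) (trans
      (sum-cong-≗ λ i → sum-cong-≗ λ j → deviation-moment l (h i j))
      (∑∑-distrib-+ (λ i j → sum λ k → sum λ k′ → ⟦ h i j k′ ≟ h i j k ⟧) λ _ _ → ∑[ e < q ] (l * l)))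

  -- The diagonal terms are never evaluated: `diagonal` makes them equal for `f` and `g`. All other
  -- terms for `f` vanish, so the remaining terms for `g` have sum zero.
  transpose-balanced : ∀ l → (∀ i k → f i i k ≡ g i i k) →
                       (∀ i i′ → i ≢ i′ → ∀ e → fibre (f i i′) e ≡ l) →
                       ∀ k k′ → k ≢ k′ → ∀ e → fibre (g k k′) e ≡ l
  transpose-balanced l diagonal balanced k k′ k≢k′ = deviation≡0⇒balanced l (g k k′)
    (off-diagonal≡0 (λ k k′ → deviation l (g k k′)) total k k′ k≢k′)
    where
    open ≡-Reasoning
    fibre-cong : ∀ i e → fibre (f i i) e ≡ fibre (g i i) e
    fibre-cong i e = sum-cong-≗ λ k → cong (λ x → ⟦ x ≟ e ⟧) (diagonal i k)
    total : sum (λ k → sum λ k′ → deviation l (g k k′)) ≡ sum (λ k → deviation l (g k k))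
    total = begin
      sum (λ k → sum λ k′ → deviation l (g k k′))  ≡⟨ deviation-total l ⟨
      sum (λ i → sum λ i′ → deviation l (f i i′))
        ≡⟨ diagonal-sum (λ i i′ → deviation l (f i i′))
             (λ i i′ i≢i′ → balanced⇒deviation≡0 l (f i i′) (balanced i i′ i≢i′)) ⟩
      sum (λ i → deviation l (f i i))
        ≡⟨ sum-cong-≗ (λ i → sum-cong-≗ λ e → cong (λ N → ∣ N - l ∣ * ∣ N - l ∣) (fibre-cong i e)) ⟩
      sum (λ k → deviation l (g k k)) ∎

-- Generalized Hadamard matrices

module FieldLemmas {q : ℕ} (𝔽 : FiniteField q) where
  open FiniteField 𝔽 public using (Carrier; 0#; 1#; size)
    renaming (_+_ to infixl 6 _+ᶠ_; -_ to infix 8 -ᶠ_; _-_ to infixl 6 _-ᶠ_)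

  abelianGroup : AbelianGroup _ _
  abelianGroup = record
    { isAbelianGroup = IsHeytingField.+-isAbelianGroup (FiniteField.isHeytingField 𝔽) }

  heytingCommutativeRing : HeytingCommutativeRing _ _ _
  heytingCommutativeRing = record
    { isHeytingCommutativeRing = IsHeytingField.isHeytingCommutativeRing (FiniteField.isHeytingField 𝔽) }

  open AbelianGroup abelianGroup public using (inverseʳ)
    renaming (identityˡ to +ᶠ-identityˡ; identityʳ to +ᶠ-identityʳ; assoc to +ᶠ-assoc; comm to +ᶠ-comm)
  open AbelianGroupProperties abelianGroup public
    using (xyx⁻¹≈y; ⁻¹-anti-homo‿-; ⁻¹-injective; ε⁻¹≈ε; inverseʳ-unique; ∙-cancelʳ)

  1≢0 : 1# ≢ 0#
  1≢0 = HeytingProperties.1#0 heytingCommutativeRing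

  index : Carrier → Fin q
  index = Inverse.to size

  element : Fin q → Carrier
  element = Inverse.from size

  index-element : ∀ k → index (element k) ≡ k
  index-element = Inverse.strictlyInverseˡ size

  element-index : ∀ x → element (index x) ≡ x
  element-index = Inverse.strictlyInverseʳ size

  index-injective : ∀ {x y} → index x ≡ index y → x ≡ y
  index-injective {x} {y} eq = trans (sym (element-index x)) (trans (cong element eq) (element-index y))

  x-0≡x : ∀ x → x -ᶠ 0# ≡ x
  x-0≡x x = trans (cong (x +ᶠ_) ε⁻¹≈ε) (+ᶠ-identityʳ x)

  -- Exchanging `w` and `z` is its own converse, so this one lemma turns equal row differences into
  -- equal column differences and back.
  difference-swap : ∀ {w x y z} → w -ᶠ x ≡ y -ᶠ z → z -ᶠ x ≡ y -ᶠ w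
  difference-swap {w} {x} {y} {z} w-x≡y-z = begin
    z +ᶠ -ᶠ x                 ≡⟨ cong (z +ᶠ_) (xyx⁻¹≈y w (-ᶠ x)) ⟨
    z +ᶠ (w +ᶠ -ᶠ x +ᶠ -ᶠ w)  ≡⟨ cong (λ d → z +ᶠ (d +ᶠ -ᶠ w)) w-x≡y-z ⟩
    z +ᶠ (y +ᶠ -ᶠ z +ᶠ -ᶠ w)  ≡⟨ +ᶠ-assoc z (y +ᶠ -ᶠ z) (-ᶠ w) ⟨
    z +ᶠ (y +ᶠ -ᶠ z) +ᶠ -ᶠ w  ≡⟨ cong (_+ᶠ -ᶠ w) (+ᶠ-assoc z y (-ᶠ z)) ⟨
    z +ᶠ y +ᶠ -ᶠ z +ᶠ -ᶠ w    ≡⟨ cong (_+ᶠ -ᶠ w) (xyx⁻¹≈y z y) ⟩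
    y +ᶠ -ᶠ w                 ∎
    where open ≡-Reasoning

module HadamardMatrix {q m : ℕ} (𝔽 : FiniteField q) (q∣v : q ∣ suc m) (H : Matrix 𝔽 (suc m))
                      (isGH : IsGH 𝔽 q∣v H) (normalized : IsNormalized 𝔽 H) where
  open FieldLemmas 𝔽

  private
    v l : ℕ
    v = suc m
    l = quotient q∣v

    h : Fin v → Fin v → Carrier
    h = entry 𝔽 H

  -- Balance of rows and columns

  l≢0 : l ≢ 0
  l≢0 = nonZero q∣v
    where
    nonZero : (d : q ∣ suc m) → quotient d ≢ 0
    nonZero (divides zero ())
    nonZero (divides (suc _) _) ()

  -- Values are transported to `Fin q`, where equality is decidable and sums over all values make
  -- sense.
  rowDifference columnDifference : Fin v → Fin v → Fin v → Fin q
  rowDifference    i i′ k = index (h i k -ᶠ h i′ k)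
  columnDifference k k′ i = index (h i k -ᶠ h i k′)

  row-balanced : ∀ i i′ → i ≢ i′ → ∀ e → fibre (rowDifference i i′) e ≡ l
  row-balanced i i′ i≢i′ e with <-cmp i i′
  ... | tri≈ _ i≡i′ _ = contradiction i≡i′ i≢i′
  ... | tri< i<i′ _ _ = count-unique (λ k → rowDifference i i′ k ≟ e)
    ((λ eq → trans (sym (element-index _)) (cong element eq)) , λ eq → trans (cong index eq) (index-element e))
    (isGH i i′ i<i′ (element e))
  -- `isGH` covers only the order `i′ < i`. Swapping the rows negates every difference, hence the
  -- value `-ᶠ element e`.
  ... | tri> _ _ i′<i = count-unique (λ k → rowDifference i i′ k ≟ e)
    ( (λ {k} eq → trans (sym (⁻¹-anti-homo‿- (h i k) (h i′ k)))
        (cong -ᶠ_ (trans (sym (element-index _)) (cong element eq))))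
    , (λ {k} eq → trans (cong index (⁻¹-injective (trans (⁻¹-anti-homo‿- (h i k) (h i′ k)) eq)))
        (index-element e)))
    (isGH i′ i i′<i (-ᶠ element e))

  column-balanced : ∀ k k′ → k ≢ k′ → ∀ e → fibre (columnDifference k k′) e ≡ l
  column-balanced = transpose-balanced rowDifference columnDifference
    (λ _ _ _ _ eq → cong index (difference-swap (index-injective eq)))
    (λ _ _ _ _ eq → cong index (difference-swap (index-injective eq)))
    l
    (λ i k → cong index (trans (inverseʳ (h i k)) (sym (inverseʳ (h k i)))))
    row-balanced

  -- Column `zero` vanishes by normalization, so the entries of column `k` are its differences with
  -- column `zero`.
  column-size : ∀ k → k ≢ zero → ∀ e → HasSize (setoid (Fin v) ↾ λ i → h i k ≡ e) l
  column-size k k≢0 e = subst (HasSize (setoid (Fin v) ↾ λ i → h i k ≡ e))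
    (column-balanced k zero k≢0 (index e))
    (HasSize-resp (↾-resp (setoid (Fin v))
      ( (λ {i} eq → cong index (trans (difference≡entry i) eq))
      , (λ {i} eq → trans (sym (difference≡entry i)) (index-injective eq))))
      (count-size v λ i → columnDifference k zero i ≟ index e))
    where
    difference≡entry : ∀ i → h i k -ᶠ h i zero ≡ h i k
    difference≡entry i = trans (cong (λ x → h i k -ᶠ x) (proj₂ normalized i)) (x-0≡x (h i k))

  -- Rows and codewords

  rows-differ : ∀ {i j} → i <ᶠ j → lookup H i ≢ lookup H j
  -- Equal rows have only zero differences, whereas the difference `1#` occurs `l` times and `l` is
  -- nonzero.
  rows-differ {i} {j} i<j eq with k , d≡1 ← inhabitant (isGH i j i<j 1#) l≢0 =
    1≢0 (trans (sym d≡1) (trans (cong (λ x → lookup x k -ᶠ h j k) eq) (inverseʳ (h j k))))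

  row-injective : ∀ i j → lookup H i ≡ lookup H j → i ≡ j
  row-injective i j eq with <-cmp i j
  ... | tri< i<j _ _ = contradiction eq (rows-differ i<j)
  ... | tri≈ _ i≡j _ = i≡j
  ... | tri> _ _ j<i = contradiction (sym eq) (rows-differ j<i)

  infixl 6 _⊹_
  _⊹_ : Vec Carrier v → Carrier → Vec Carrier v
  x ⊹ α = _⊕_ 𝔽 x (replicate v α)

  lookup-⊹ : ∀ x α k → lookup (x ⊹ α) k ≡ lookup x k +ᶠ α
  lookup-⊹ x α k = trans (lookup-zipWith _+ᶠ_ k x (replicate v α)) (cong (lookup x k +ᶠ_) (lookup-replicate k α))

  ⊹-identityʳ : ∀ x → x ⊹ 0# ≡ x
  ⊹-identityʳ = zipWith-identityʳ +ᶠ-identityʳ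

  lookup-injective : ∀ {x y : Vec Carrier v} → (∀ k → lookup x k ≡ lookup y k) → x ≡ y
  lookup-injective {x} {y} eq = trans (sym (tabulate∘lookup x)) (trans (tabulate-cong eq) (tabulate∘lookup y))

  first-of-codeword : ∀ i α → lookup (lookup H i ⊹ α) zero ≡ α
  first-of-codeword i α = trans (lookup-⊹ (lookup H i) α zero)
    (trans (cong (_+ᶠ α) (proj₂ normalized i)) (+ᶠ-identityˡ α))

  -- Rows start with `0#`, so the first coordinate recovers the added constant; cancelling it leaves
  -- equal rows.
  codeword-injective : ∀ i j α β → lookup H i ⊹ α ≡ lookup H j ⊹ β → i ≡ j × α ≡ β
  codeword-injective i j α β eq with
    trans (sym (first-of-codeword i α)) (trans (cong (λ x → lookup x zero) eq) (first-of-codeword j β))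
  ... | refl = row-injective i j (lookup-injective λ k → ∙-cancelʳ α _ _
      (trans (sym (lookup-⊹ (lookup H i) α k)) (trans (cong (λ x → lookup x k) eq)
        (lookup-⊹ (lookup H j) α k)))) , refl

  C F : Code 𝔽 v
  C = HadamardCode 𝔽 H
  F = Rows 𝔽 H

  row∈C : ∀ i → lookup H i ∈ C
  row∈C i = lookup H i , 0# , (i , refl) , sym (⊹-identityʳ _)

  rows-are-D₁ : F ≐ FirstCoordinateZero 𝔽 C
  rows-are-D₁ = (λ { (i , refl) → row∈C i , proj₂ normalized i })
    , λ { ((_ , α , (i , refl) , refl) , first≡0) → i ,
          trans (cong (lookup H i ⊹_) (trans (sym (first-of-codeword i α)) first≡0)) (⊹-identityʳ _) }

  codewords : Setoid _ _
  codewords = setoid (Vec Carrier v) ↾ C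

  -- The row index and the constant come from the membership proof, which equality of codewords
  -- ignores; `codeword-injective` makes the map well defined.
  codewords-size : HasSize codewords (v * q)
  codewords-size = mkHasSize codewords
    (λ { (_ , _ , α , (i , _) , _) → combine i (index α) })
    (λ k → let (i , e) = remQuot q k in lookup H i ⊹ element e , lookup H i , element e , (i , refl) , refl)
    (λ { {_ , _ , α , (i , refl) , refl} {_ , _ , β , (j , refl) , refl} eq →
         cong₂ (λ i α → combine i (index α))
           (proj₁ (codeword-injective i j α β eq)) (proj₂ (codeword-injective i j α β eq)) })
    (λ k → let (i , e) = remQuot {v} q k in trans (cong (combine i) (index-element e)) (combine-remQuot {v} q k))
    (λ { (_ , _ , α , (i , refl) , refl) → trans
         (cong (λ (i , e) → lookup H i ⊹ element e) (remQuot-combine i (index α)))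
         (cong (lookup H i ⊹_) (element-index α)) })

  rows-size : HasSize (codewords ↾ λ x → proj₁ x ∈ F) v
  rows-size = mkHasSize (codewords ↾ λ x → proj₁ x ∈ F)
    (λ { (_ , i , _) → i })
    (λ i → (lookup H i , row∈C i) , i , refl)
    (λ { {_ , i , refl} {_ , j , refl} eq → row-injective i j eq })
    (λ _ → refl)
    (λ { (_ , i , eq) → sym eq })

  -- The propelinear group and its constants

  module Propelinear (P : FullPropelinear 𝔽 C) where
    open FullPropelinear P using (π; π-fixfree; π-constants)
    open StarGroup 𝔽 P using (permute-cong)

    E : Group _ _
    E = propelinearGroup 𝔽 P

    open Group E using (_≈_; _∙_; _⁻¹; ε; ∙-congˡ; ∙-congʳ) renaming (Carrier to Codeword)
    private module E = Group E
    open GroupProperties E using (//-rightDividesˡ; //-rightDividesʳ) renaming (inverseʳ-unique to ⁻¹-unique)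

    C₁ R : Pred Codeword _
    C₁ = within 𝔽 P (Constants 𝔽 v)
    R  = within 𝔽 P F

    -- Constants are codewords because the first row of `H` is zero.
    constant : Carrier → Codeword
    constant α = replicate v α , lookup H zero , α , (zero , refl) , lookup-injective λ k →
      trans (lookup-replicate k α)
        (sym (trans (lookup-⊹ (lookup H zero) α k) (trans (cong (_+ᶠ α) (proj₁ normalized k)) (+ᶠ-identityˡ α))))

    constant-injective : ∀ {α β} → replicate v α ≡ replicate v β → α ≡ β
    constant-injective = cong (λ (x : Vec Carrier v) → lookup x zero)

    C₁-resp : C₁ Respects _≈_
    C₁-resp x≈y (α , x≡α) = α , trans (sym x≈y) x≡α

    permute-constant : ∀ σ α → permute σ (replicate v α) ≡ replicate v α
    permute-constant σ α = lookup-injective λ k →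
      trans (lookup∘tabulate (λ i → lookup (replicate v α) (σ ⟨$⟩ˡ i)) k)
        (trans (lookup-replicate (σ ⟨$⟩ˡ k) α) (sym (lookup-replicate k α)))

    -- Every permutation fixes a constant vector.
    ⋆-constant : ∀ x {z} α → proj₁ z ≡ replicate v α → proj₁ (x ∙ z) ≡ proj₁ x ⊹ α
    ⋆-constant (x , x∈C) α refl = cong (_⊕_ 𝔽 x) (permute-constant (π x x∈C) α)

    -- The permutation of a constant is the identity. Together with `⋆-constant` this gives
    -- centrality.
    constant-⋆ : ∀ {z} x α → proj₁ z ≡ replicate v α → proj₁ (z ∙ x) ≡ proj₁ x ⊹ α
    constant-⋆ {z , z∈C} (x , _) α refl = trans
      (cong (_⊕_ 𝔽 z) (trans (permute-cong (π z z∈C) Perm.id (π-constants z z∈C (α , refl)) x) (tabulate∘lookup x)))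
      (zipWith-comm +ᶠ-comm z x)

    central : IsCentral E C₁
    central {z} (α , z≡α) x = trans (constant-⋆ {z} x α z≡α) (sym (⋆-constant x {z} α z≡α))

    C₁-isNormalSubgroup : IsNormalSubgroup E C₁
    C₁-isNormalSubgroup = record
      { isSubgroup = record
        { resp      = λ {x} {y} → C₁-resp {x} {y}
        ; ε-closed  = 0# , refl
        ; ∙-closed  = λ {x} {y} (α , x≡α) (β , y≡β) → α +ᶠ β , ∙-constants {x} {y} α β x≡α y≡β
        -- Group inverses come from `star-C` without a formula; uniqueness identifies this one with
        -- the constant `-ᶠ α`.
        ; ⁻¹-closed = λ {x} (α , x≡α) → -ᶠ α , sym (⁻¹-unique x (constant (-ᶠ α))
            (trans (∙-constants {x} {constant (-ᶠ α)} α (-ᶠ α) x≡α refl) (cong (replicate v) (inverseʳ α))))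
        }
      ; conjugate = λ g {z} z∈C₁ → C₁-resp {z} {g ∙ z ∙ g ⁻¹} (sym (E.trans {g ∙ z ∙ g ⁻¹} {z ∙ g ∙ g ⁻¹} {z}
          (∙-congʳ {g ⁻¹} {g ∙ z} {z ∙ g} (sym (central {z} z∈C₁ g))) (//-rightDividesʳ g z))) z∈C₁
      }
      where
      ∙-constants : ∀ {x y} α β → proj₁ x ≡ replicate v α → proj₁ y ≡ replicate v β →
                    proj₁ (x ∙ y) ≡ replicate v (α +ᶠ β)
      ∙-constants {x} {y} α β x≡α y≡β = trans (⋆-constant x {y} β y≡β)
        (trans (cong (_⊹ β) x≡α) (zipWith-replicate _+ᶠ_ α β))

    C₁-size : HasSize (E.setoid ↾ C₁) q
    C₁-size = mkHasSize (E.setoid ↾ C₁)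
      (λ (_ , α , _) → index α)
      (λ e → constant (element e) , element e , refl)
      (λ { {_ , _ , x≡α} {_ , _ , y≡β} x≡y → cong index (constant-injective (trans (sym x≡α) (trans x≡y y≡β))) })
      index-element
      (λ (_ , α , x≡α) → trans (cong (replicate v) (element-index α)) (sym x≡α))

    -- Quotients of distinct rows

    DistinctPairs : Setoid _ _
    DistinctPairs = (E.setoid ×ₛ E.setoid) ↾ λ (r₁ , r₂) → r₁ ∈ R × r₂ ∈ R × ¬ r₁ ≈ r₂

    quotients : Setoid.Carrier DistinctPairs → Codeword
    quotients ((r₁ , r₂) , _) = r₁ ∙ r₂ ⁻¹

    numerator : ∀ r₁ r₂ e → r₁ ∙ r₂ ⁻¹ ≈ e → r₁ ≈ e ∙ r₂
    numerator r₁ r₂ e r₁/r₂≈e = trans (sym (//-rightDividesˡ r₂ r₁)) (∙-congʳ {r₂} {r₁ ∙ r₂ ⁻¹} {e} r₁/r₂≈e)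

    -- A quotient in `C₁` makes `r₁` a constant shift of `r₂`. Both start with `0#`, so the shift is
    -- zero, against distinctness.
    quotients-inside : ∀ d → quotients d ∉ C₁
    quotients-inside ((r₁ , r₂) , r₁∈R , r₂∈R , r₁≉r₂) (α , r₁/r₂≡α) = r₁≉r₂
      (trans r₁≡r₂⊹α (trans (cong (proj₁ r₂ ⊹_) α≡0) (⊹-identityʳ (proj₁ r₂))))
      where
      open ≡-Reasoning
      r₁≡r₂⊹α : proj₁ r₁ ≡ proj₁ r₂ ⊹ α
      r₁≡r₂⊹α = trans (numerator r₁ r₂ (r₁ ∙ r₂ ⁻¹) refl) (constant-⋆ {r₁ ∙ r₂ ⁻¹} r₂ α r₁/r₂≡α)
      α≡0 : α ≡ 0#
      α≡0 = begin
        α                           ≡⟨ +ᶠ-identityˡ α ⟨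
        0# +ᶠ α                     ≡⟨ cong (_+ᶠ α) (proj₂ (proj₁ rows-are-D₁ r₂∈R)) ⟨
        lookup (proj₁ r₂) zero +ᶠ α ≡⟨ lookup-⊹ (proj₁ r₂) α zero ⟨
        lookup (proj₁ r₂ ⊹ α) zero  ≡⟨ cong (λ x → lookup x zero) r₁≡r₂⊹α ⟨
        lookup (proj₁ r₁) zero      ≡⟨ proj₂ (proj₁ rows-are-D₁ r₁∈R) ⟩
        0#                          ∎

    module _ (e : Codeword) (e∉C₁ : e ∉ C₁) where
      private
        -- `permute` reads through the inverse permutation, so the first coordinate of `e ∙ x`
        -- involves coordinate `j` of `x`.
        j : Fin v
        j = π (proj₁ e) (proj₂ e) ⟨$⟩ˡ zero

        e₀ : Carrier
        e₀ = lookup (proj₁ e) zero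

        row : Fin v → Codeword
        row i = lookup H i , row∈C i

      -- Otherwise the permutation of the nonconstant codeword `e` would fix `zero`.
      j≢0 : j ≢ zero
      j≢0 j≡0 = π-fixfree (proj₁ e) (proj₂ e) e∉C₁ zero
        (trans (cong (π (proj₁ e) (proj₂ e) ⟨$⟩ʳ_) (sym j≡0)) (Perm.inverseʳ (π (proj₁ e) (proj₂ e))))

      first-of-⋆ : ∀ x → lookup (proj₁ (e ∙ x)) zero ≡ e₀ +ᶠ lookup (proj₁ x) j
      first-of-⋆ x = trans
        (lookup-zipWith _+ᶠ_ zero (proj₁ e) (permute (π (proj₁ e) (proj₂ e)) (proj₁ x)))
        (cong (e₀ +ᶠ_) (lookup∘tabulate (λ i → lookup (proj₁ x) (π (proj₁ e) (proj₂ e) ⟨$⟩ˡ i)) zero))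

      e⋆row∈R : ∀ i → h i j ≡ -ᶠ e₀ → e ∙ row i ∈ R
      e⋆row∈R i hᵢⱼ≡ = proj₂ rows-are-D₁ (proj₂ (e ∙ row i) ,
        trans (first-of-⋆ (row i)) (trans (cong (e₀ +ᶠ_) hᵢⱼ≡) (inverseʳ e₀)))

      -- Ensures that the two members of a constructed pair are distinct: a fixed `x` would give
      -- `e ≈ ε`, and the identity is constant.
      ⋆-moves : ∀ x → ¬ e ∙ x ≈ x
      ⋆-moves x e⋆x≈x = e∉C₁ (0# , trans (sym (//-rightDividesʳ x e))
        (trans (∙-congʳ {x ⁻¹} {e ∙ x} {x} e⋆x≈x) (E.inverseʳ x)))

      -- Since `r₁ ≈ e ∙ r₂`, a pair amounts to the index of the row `r₂`; that `r₁` starts with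
      -- `0#` becomes the condition on column `j`.
      pairs↔rows : Inverse (DistinctPairs ↾ λ d → quotients d ≈ e) (setoid (Fin v) ↾ λ i → h i j ≡ -ᶠ e₀)
      pairs↔rows = mkInverse
        {S = DistinctPairs ↾ λ d → quotients d ≈ e} {T = setoid (Fin v) ↾ λ i → h i j ≡ -ᶠ e₀}
        (λ (((r₁ , r₂) , r₁∈R , (i , r₂≡) , _) , eq) → i , inverseʳ-unique e₀ (h i j) (begin
          e₀ +ᶠ h i j                  ≡⟨ cong (λ x → e₀ +ᶠ lookup x j) r₂≡ ⟨
          e₀ +ᶠ lookup (proj₁ r₂) j    ≡⟨ first-of-⋆ r₂ ⟨
          lookup (proj₁ (e ∙ r₂)) zero ≡⟨ cong (λ x → lookup x zero) (numerator r₁ r₂ e eq) ⟨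
          lookup (proj₁ r₁) zero       ≡⟨ proj₂ (proj₁ rows-are-D₁ r₁∈R) ⟩
          0#                           ∎))
        (λ (i , hᵢⱼ≡) → ((e ∙ row i , row i) , e⋆row∈R i hᵢⱼ≡ , (i , refl) , ⋆-moves (row i)) ,
                        //-rightDividesʳ (row i) e)
        (λ { {(_ , _ , (i , r≡) , _) , _} {(_ , _ , (i′ , r′≡) , _) , _} (_ , r≡r′) →
             row-injective i i′ (trans (sym r≡) (trans r≡r′ r′≡)) })
        (λ { {i , _} {.i , _} refl → refl , refl })
        (λ _ → refl)
        (λ (((r₁ , r₂) , _ , (i , r₂≡) , _) , eq) →
          trans (∙-congˡ {e} {row i} {r₂} (sym r₂≡)) (sym (numerator r₁ r₂ e eq)) , sym r₂≡)
        where open ≡-Reasoning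

      quotients-outside : Contains DistinctPairs E.setoid quotients e l
      quotients-outside = HasSize-resp pairs↔rows (column-size j j≢0 (-ᶠ e₀))

    isCentralRelativeDifferenceSet : IsCentralRelativeDifferenceSet E R C₁ v q v l
    isCentralRelativeDifferenceSet = record
      { isRelativeDifferenceSet = record
        { order             = codewords-size
        ; isNormalSubgroup  = C₁-isNormalSubgroup
        ; order-Z           = C₁-size
        ; R-resp            = λ { refl x∈F → x∈F }
        ; size-R            = rows-size
        ; quotients-outside = quotients-outside
        ; quotients-inside  = quotients-inside
        }
      ; central = λ {z} → central {z}
      }

    -- The homomorphism laws hold by `refl` because the closure proofs in `C₁-isNormalSubgroup`
    -- supply exactly `0#`, `α +ᶠ β` and `-ᶠ α` as witnesses.
    C₁≅𝔽 : IsNormalSubgroup.group C₁-isNormalSubgroup ≅ FiniteField.+-group 𝔽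
    C₁≅𝔽 = (λ (_ , α , _) → α) , record
      { isGroupMonomorphism = record
        { isGroupHomomorphism = record
          { isMonoidHomomorphism = record
            { isMagmaHomomorphism = record
              { isRelHomomorphism = record { cong = λ {x} {y} → value-cong {x} {y} }
              ; homo              = λ _ _ → refl
              }
            ; ε-homo = refl
            }
          ; ⁻¹-homo = λ _ → refl
          }
        ; injective = λ { {_ , α , x≡α} {_ , .α , y≡α} refl → trans x≡α (sym y≡α) }
        }
      ; surjective = λ α → (constant α , α , refl) , λ {z} → value-cong {z} {constant α , α , refl}
      }
      where
      -- Equal elements may carry different proofs, so the witness has to be recovered from the
      -- vector itself.
      value-cong : {x y : ∃ C₁} → proj₁ x ≈ proj₁ y → proj₁ (proj₂ x) ≡ proj₁ (proj₂ y)
      value-cong {_ , _ , x≡α} {_ , _ , y≡β} x≡y = constant-injective (trans (sym x≡α) (trans x≡y y≡β))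

proposition3p8 :
    ∀ (q m : ℕ) → IsPrimePower q → (𝔽 : FiniteField q) →
    (q∣v : q ∣ suc m) (H : Matrix 𝔽 (suc m)) → IsGH 𝔽 q∣v H → IsNormalized 𝔽 H →
    (P : FullPropelinear 𝔽 (HadamardCode 𝔽 H)) →
    let v  = suc m
        E  = propelinearGroup 𝔽 P
        C₁ = within 𝔽 P (Constants 𝔽 v)
        F  = within 𝔽 P (Rows 𝔽 H)
    in Rows 𝔽 H ≐ FirstCoordinateZero 𝔽 (HadamardCode 𝔽 H) ×
       (Σ[ rds ∈ IsCentralRelativeDifferenceSet E F C₁ v q v (quotient q∣v) ]
          IsCentralRelativeDifferenceSet.group rds ≅ FiniteField.+-group 𝔽)
proposition3p8 q m _ 𝔽 q∣v H isGH normalized P =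
  rows-are-D₁ , isCentralRelativeDifferenceSet , C₁≅𝔽
  where
  open HadamardMatrix 𝔽 q∣v H isGH normalized
  open Propelinear P
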